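{- Let $n$ be a positive integer. (a) $\mu(n,3)=\mu(n,2)$. (b) If $n\ge 3$, then $\mu^*(n,3)=4k-1$ if $n=6k-3$ for some positive integer $k$, and $\mu^*(n,3)=\mu(n,3)$ otherwise.
   Context: Let $\mathbb F_2=\{0,1\}$ be the field with two elements. For $u\in\mathbb F_2^n$, $|u|$ denotes the Hamming weight of $u$ (the number of entries equal to $1$). A wiring on $n$ vertices is a matrix $W=(w_{i,j})\in M(n,n;\mathbb F_2)$ with $w_{i,i}=1$ for all $i$. The degree of vertex $j$ is the number of $1$s in the $j$th column of $W$, and $\deg(W)$ is the maximum degree over all vertices. For $c\in\mathbb F_2^n$, $M(W,c)=\max\{|Wx+c| : x\in\mathbb F_2^n\}$. For $n,m\ge1$, $A(n,m)$ is the set of wirings on $n$ vertices with $\deg(W)\le m$; for $n\ge m$, $A^*(n,m)$ is the set of wirings on $n$ vertices in which every vertex has degree exactly $m$. Define $\mu(n,m)=\min\{M(W,0): W\in A(n,m)\}$ and, for $n\ge m$, $\mu^*(n,m)=\min\{M(W,0): W\in A^*(n,m)\}$. -}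

module Defs where

open import Data.Fin.Base using (Fin; zero; suc)
open import Data.Fin.Properties using (all?)
open import Data.List.Base as List using (List; filter; cartesianProductWith)
open import Data.List.Extrema.Nat using (argmin; argmax; argmin-all; f[argmin]≤v⁺; v≤f[argmax]⁺)
open import Data.List.Membership.Propositional using (find; lose)
open import Data.List.Membership.Propositional.Properties using (∈-filter⁺)
open import Data.List.Relation.Unary.All.Properties using (all-filter)
open import Data.List.Relation.Unary.Any as Any using (Any; here; there)
open import Data.List.Relation.Unary.Any.Properties using (cartesianProductWith⁺)
open import Data.Nat.Base using (ℕ; zero; suc; _≤_; _⊔_; z≤n; s≤s; NonZero; >-nonZero⁻¹)
open import Data.Nat.Properties using (≤-reflexive; ≤-antisym; ≤-trans; ⊔-lub; _≤?_) renaming (_≟_ to _≟ℕ_)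
open import Data.Parity.Base using (Parity; 0ℙ; 1ℙ; _+_; _*_)
open import Data.Parity.Properties using (+-0-monoid) renaming (_≟_ to _≟ℙ_)
open import Data.Product.Base using (∃; _×_; _,_; proj₁; proj₂)
open import Data.Sum.Base using (inj₂)
open import Data.Vec.Base as Vec using ()
open import Data.Vec.Properties using (tabulate-cong)
open import Data.Vec.Functional using (Vector; []; _∷_; foldr; toVec; replicate; zipWith)
open import Function.Base using (_∘_)
open import Level using (0ℓ)
open import Relation.Binary.Core using (Rel)
open import Relation.Binary.PropositionalEquality using (_≡_; _≗_; refl; sym; trans; cong; cong₂; subst)
open import Relation.Nullary.Decidable using (_×-dec_)
open import Relation.Unary using (Pred; Decidable)

open import Algebra.Properties.Monoid.Sum +-0-monoid using (sum; sum-cong-≗)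

𝔽₂ : Set
𝔽₂ = Parity

-- W i j is the entry in row i and column j.
Matrix : ℕ → ℕ → Set
Matrix m n = Vector (Vector 𝔽₂ n) m

infixl 7 _*ᵥ_
infixl 6 _+ᵥ_

_*ᵥ_ : ∀ {m n} → Matrix m n → Vector 𝔽₂ n → Vector 𝔽₂ m
(W *ᵥ x) i = sum (λ j → W i j * x j)

_+ᵥ_ : ∀ {n} → Vector 𝔽₂ n → Vector 𝔽₂ n → Vector 𝔽₂ n
_+ᵥ_ = zipWith _+_

0ᵥ : ∀ {n} → Vector 𝔽₂ n
0ᵥ = replicate _ 0ℙ

∣_∣ : ∀ {n} → Vector 𝔽₂ n → ℕ
∣ u ∣ = Vec.count (_≟ℙ 1ℙ) (toVec u)

IsWiring : ∀ {n} → Matrix n n → Set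
IsWiring W = ∀ i → W i i ≡ 1ℙ

degree : ∀ {n} → Matrix n n → Fin n → ℕ
degree W j = ∣ (λ i → W i j) ∣

deg : ∀ {n} → Matrix n n → ℕ
deg W = foldr _⊔_ 0 (degree W)

A : ∀ n → ℕ → Pred (Matrix n n) 0ℓ
A n m W = IsWiring W × deg W ≤ m

A* : ∀ n → ℕ → Pred (Matrix n n) 0ℓ
A* n m W = IsWiring W × (∀ j → degree W j ≡ m)

IsGreatest : Pred ℕ 0ℓ → ℕ → Set
IsGreatest S v = S v × (∀ k → S k → k ≤ v)

IsLeast : Pred ℕ 0ℓ → ℕ → Set
IsLeast S v = S v × (∀ k → S k → v ≤ k)

------------------------------------------------------------------------
-- Existence of extrema over the finite sets of vectors and matrices.
-- Vectors are functions, so exhaustiveness of an enumeration is stated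
-- up to pointwise equality.

private
  variable
    B : Set
    n : ℕ

vectors : List B → ∀ n → List (Vector B n)
vectors xs zero    = List.[ [] ]
vectors xs (suc n) = cartesianProductWith _∷_ xs (vectors xs n)

vectors-exhaustive : {R : Rel B 0ℓ} (xs : List B) → (∀ b → Any (R b) xs) →
                     ∀ n (v : Vector B n) → Any (λ w → ∀ i → R (v i) (w i)) (vectors xs n)
vectors-exhaustive xs ex zero    v = here λ ()
vectors-exhaustive xs ex (suc n) v =
  cartesianProductWith⁺ _∷_ (λ r rs → λ { zero → r ; (suc i) → rs i })
    (ex (v zero)) (vectors-exhaustive xs ex n (v ∘ suc))

𝔽₂-elements : List 𝔽₂
𝔽₂-elements = 0ℙ List.∷ 1ℙ List.∷ List.[]

𝔽₂-exhaustive : ∀ p → Any (p ≡_) 𝔽₂-elements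
𝔽₂-exhaustive 0ℙ = here refl
𝔽₂-exhaustive 1ℙ = there (here refl)

infix 4 _≗ₘ_

_≗ₘ_ : ∀ {m n} → Rel (Matrix m n) 0ℓ
W ≗ₘ W′ = ∀ i → W i ≗ W′ i

allVectors : ∀ n → List (Vector 𝔽₂ n)
allVectors = vectors 𝔽₂-elements

allVectors-exhaustive : (x : Vector 𝔽₂ n) → Any (x ≗_) (allVectors n)
allVectors-exhaustive = vectors-exhaustive 𝔽₂-elements 𝔽₂-exhaustive _

allMatrices : ∀ m n → List (Matrix m n)
allMatrices m n = vectors (allVectors n) m

allMatrices-exhaustive : ∀ {m} (W : Matrix m n) → Any (W ≗ₘ_) (allMatrices m n)
allMatrices-exhaustive = vectors-exhaustive (allVectors _) allVectors-exhaustive _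

-- Abstract, so that terms do not unfold into the search; the extrema are
-- determined by IsGreatest and IsLeast.
abstract
  greatest-exists : (f : B → ℕ) (R : Rel B 0ℓ) (xs : List B) → (∀ b → Any (R b) xs) →
                    (∀ {b c} → R b c → f b ≡ f c) → B →
                    ∃ (IsGreatest (λ k → ∃ λ b → f b ≡ k))
  greatest-exists f R xs ex f-cong b₀ =
    f (argmax f b₀ xs) , (_ , refl) , λ { _ (b , refl) →
      v≤f[argmax]⁺ b₀ xs (inj₂ (Any.map (≤-reflexive ∘ f-cong) (ex b))) }

  least-exists : (f : B → ℕ) {P : Pred B 0ℓ} → Decidable P →
                 (R : Rel B 0ℓ) (xs : List B) → (∀ b → Any (R b) xs) →
                 (∀ {b c} → R b c → f b ≡ f c) → (∀ {b c} → R b c → P b → P c) → ∃ P →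
                 ∃ (IsLeast (λ k → ∃ λ b → P b × f b ≡ k))
  least-exists f {P} P? R xs ex f-cong P-resp (b₀ , pb₀) =
    f (argmin f b₀ (filter P? xs)) , (_ , argmin-all f pb₀ (all-filter P? xs) , refl) , minimal
    where
    minimal : ∀ k → (∃ λ b → P b × f b ≡ k) → f (argmin f b₀ (filter P? xs)) ≤ k
    minimal _ (b , pb , refl) with find (ex b)
    ... | c , c∈xs , r = f[argmin]≤v⁺ b₀ (filter P? xs)
      (inj₂ (lose (∈-filter⁺ P? c∈xs (P-resp r pb)) (≤-reflexive (sym (f-cong r)))))

∣∣-cong : {u v : Vector 𝔽₂ n} → u ≗ v → ∣ u ∣ ≡ ∣ v ∣
∣∣-cong u≗v = cong (Vec.count (_≟ℙ 1ℙ)) (tabulate-cong u≗v)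

∣*ᵥ+ᵥ∣-cong : {W W′ : Matrix n n} {x x′ : Vector 𝔽₂ n} (c : Vector 𝔽₂ n) →
              W ≗ₘ W′ → x ≗ x′ → ∣ W *ᵥ x +ᵥ c ∣ ≡ ∣ W′ *ᵥ x′ +ᵥ c ∣
∣*ᵥ+ᵥ∣-cong c W≗ x≗ =
  ∣∣-cong λ i → cong (_+ c i) (sum-cong-≗ λ j → cong₂ _*_ (W≗ i j) (x≗ j))

M-exists : (W : Matrix n n) (c : Vector 𝔽₂ n) →
           ∃ (IsGreatest (λ k → ∃ λ x → ∣ W *ᵥ x +ᵥ c ∣ ≡ k))
M-exists {n} W c = greatest-exists (λ x → ∣ W *ᵥ x +ᵥ c ∣) _≗_
  (allVectors n) allVectors-exhaustive
  (∣*ᵥ+ᵥ∣-cong {W = W} c (λ _ _ → refl)) 0ᵥ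

M : Matrix n n → Vector 𝔽₂ n → ℕ
M W c = proj₁ (M-exists W c)

M-cong : {W W′ : Matrix n n} (c : Vector 𝔽₂ n) → W ≗ₘ W′ → M W c ≡ M W′ c
M-cong {n} c W≗ = ≤-antisym (half W≗) (half λ i j → sym (W≗ i j))
  where
  half : {W W′ : Matrix n n} → W ≗ₘ W′ → M W c ≤ M W′ c
  half {W} {W′} W≗ with M-exists W c
  ... | v , (x , eq) , _ = proj₂ (proj₂ (M-exists W′ c)) v
    (x , trans (sym (∣*ᵥ+ᵥ∣-cong c W≗ (λ _ → refl))) eq)

degree-cong : {W W′ : Matrix n n} → W ≗ₘ W′ → ∀ j → degree W j ≡ degree W′ j
degree-cong W≗ j = ∣∣-cong λ i → W≗ i j

foldr-⊔-cong : {u v : Vector ℕ n} → u ≗ v → foldr _⊔_ 0 u ≡ foldr _⊔_ 0 v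
foldr-⊔-cong {zero}  u≗v = refl
foldr-⊔-cong {suc n} u≗v = cong₂ _⊔_ (u≗v zero) (foldr-⊔-cong (u≗v ∘ suc))

foldr-⊔-lub : ∀ {m} {u : Vector ℕ n} → (∀ i → u i ≤ m) → foldr _⊔_ 0 u ≤ m
foldr-⊔-lub {zero}  u≤m = z≤n
foldr-⊔-lub {suc n} u≤m = ⊔-lub (u≤m zero) (foldr-⊔-lub (u≤m ∘ suc))

isWiring? : Decidable (IsWiring {n})
isWiring? W = all? λ i → W i i ≟ℙ 1ℙ

A? : ∀ m → Decidable (A n m)
A? m W = isWiring? W ×-dec (deg W ≤? m)

A*? : ∀ m → Decidable (A* n m)
A*? m W = isWiring? W ×-dec all? λ j → degree W j ≟ℕ m

A-resp : ∀ {m} {W W′ : Matrix n n} → W ≗ₘ W′ → A n m W → A n m W′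
A-resp {m = m} W≗ (wir , d) =
  (λ i → trans (sym (W≗ i i)) (wir i)) , subst (_≤ m) (foldr-⊔-cong (degree-cong W≗)) d

A*-resp : ∀ {m} {W W′ : Matrix n n} → W ≗ₘ W′ → A* n m W → A* n m W′
A*-resp W≗ (wir , d) =
  (λ i → trans (sym (W≗ i i)) (wir i)) , λ j → trans (sym (degree-cong W≗ j)) (d j)

-- The first m entries are 1.
ones : (m : ℕ) → Vector 𝔽₂ n
ones {zero}  m       = []
ones {suc n} zero    = 0ℙ ∷ ones zero
ones {suc n} (suc m) = 1ℙ ∷ ones m

∣ones∣ : ∀ {m n} → m ≤ n → ∣ ones {n} m ∣ ≡ m
∣ones∣ {n = zero}  z≤n     = refl
∣ones∣ {n = suc n} z≤n     = ∣ones∣ {n = n} z≤n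
∣ones∣             (s≤s p) = cong suc (∣ones∣ p)

-- A vector of weight 1 + m whose jth entry is 1.
column : (m : ℕ) → Fin n → Vector 𝔽₂ n
column m       zero    = 1ℙ ∷ ones m
column zero    (suc j) = 0ℙ ∷ column zero j
column (suc m) (suc j) = 1ℙ ∷ column m j

column-diagonal : ∀ m (j : Fin n) → column m j j ≡ 1ℙ
column-diagonal m       zero    = refl
column-diagonal zero    (suc j) = column-diagonal zero j
column-diagonal (suc m) (suc j) = column-diagonal m j

∣column∣ : ∀ m (j : Fin n) → suc m ≤ n → ∣ column m j ∣ ≡ suc m
∣column∣         m       zero          (s≤s p)       = cong suc (∣ones∣ p)
∣column∣ {suc (suc n)} zero    (suc j) _             = ∣column∣ zero j (s≤s z≤n)
∣column∣         (suc m) (suc j)       (s≤s p)       = cong suc (∣column∣ m j p)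

A*-nonempty : ∀ n m → .{{NonZero m}} → m ≤ n → ∃ (A* n m)
A*-nonempty n (suc m) m<n =
  (λ i j → column m j i) , column-diagonal m , λ j → ∣column∣ m j m<n

A-nonempty : ∀ n m → .{{NonZero m}} → ∃ (A n m)
A-nonempty zero    m = [] , (λ ()) , z≤n
A-nonempty (suc n) m with A*-nonempty (suc n) 1 (s≤s z≤n)
... | W , wir , d = W , wir ,
  foldr-⊔-lub λ j → ≤-trans (≤-reflexive (d j)) (>-nonZero⁻¹ m)

------------------------------------------------------------------------

μ-exists : ∀ n m → .{{_ : NonZero m}} →
           ∃ (IsLeast (λ k → ∃ λ W → A n m W × M W 0ᵥ ≡ k))
μ-exists n m = least-exists (λ W → M W 0ᵥ) (A? m) _≗ₘ_
  (allMatrices n n) allMatrices-exhaustive (M-cong 0ᵥ) A-resp (A-nonempty n m)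

μ*-exists : ∀ n m → .{{_ : NonZero m}} → m ≤ n →
            ∃ (IsLeast (λ k → ∃ λ W → A* n m W × M W 0ᵥ ≡ k))
μ*-exists n m m≤n = least-exists (λ W → M W 0ᵥ) (A*? m) _≗ₘ_
  (allMatrices n n) allMatrices-exhaustive (M-cong 0ᵥ) A*-resp (A*-nonempty n m m≤n)

μ : ∀ n m → .{{_ : NonZero m}} → ℕ
μ n m = proj₁ (μ-exists n m)

μ* : ∀ n m → .{{_ : NonZero m}} → m ≤ n → ℕ
μ* n m m≤n = proj₁ (μ*-exists n m m≤n)

{-# OPTIONS --safe #-}

-- Let c = W x have maximal weight M and let Z be the complement of the support
-- of c.  Adding the column of j ∈ Z to c does not increase the weight, so a
-- column of weight at most 3 meets Z in j only.  Hence the sum s of the columns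
-- indexed by Z contains Z, and ∣ s ∣ + ∣ c + s ∣ = 2 ∣ Z ∣ + M.  Both terms are
-- at most M, so 2 ∣ Z ∣ ≤ M, that is, 2 n ≤ 3 M.  In case of equality
-- ∣ s ∣ = M = 2 ∣ Z ∣; if all columns have weight 3 then ∣ s ∣ has the parity of
-- ∣ Z ∣, so ∣ Z ∣ and n = 3 ∣ Z ∣ are even.  Block sums of small wirings show
-- that these bounds are sharp.
module Submission where

open import Defs
import Algebra.Properties.CommutativeMonoid.Sum as CommutativeMonoidSum
import Algebra.Properties.Semiring.Sum as SemiringSum
open import Data.Fin.Base using (Fin; zero; suc; _↑ˡ_; _↑ʳ_; splitAt)
open import Data.Fin.Properties using (all?; splitAt-↑ˡ; splitAt-↑ʳ; join-splitAt) renaming (_≟_ to _≟ᶠ_)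
open import Data.List.Relation.Unary.All as All using (All)
open import Data.List.Membership.Propositional using (find)
open import Data.Nat.Base using (ℕ; zero; suc; _+_; _≤_; _*_; _∸_; _⊔_; z≤n; s≤s; NonZero; parity)
open import Data.Nat.Properties
open import Data.Nat.Solver using (module +-*-Solver)
open import Data.Parity.Base as ℙ using (0ℙ; 1ℙ)
import Data.Parity.Properties as ℙₚ
open import Data.Product.Base using (∃; _×_; _,_; proj₂)
open import Data.Sum.Base using (_⊎_; inj₁; inj₂)
open import Data.Vec.Base using (Vec; []; _∷_; lookup)
open import Data.Vec.Functional using (Vector; foldr)
open import Function.Base using (_∘_)
open import Level using (0ℓ)
open import Relation.Binary.PropositionalEquality using (_≡_; _≢_; _≗_; refl; sym; trans; cong; cong₂; subst; module ≡-Reasoning)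
open import Relation.Nullary.Decidable using (Dec; yes; no; True; toWitness; _×-dec_)
open import Relation.Nullary.Negation using (¬_; contradiction)
open import Relation.Unary using (Pred; Decidable)

open SemiringSum ℙₚ.+-*-semiring using (sum; sum-cong-≗; sum-replicate-zero; ∑-distrib-+; ∑-comm; *-distribʳ-sum)
open CommutativeMonoidSum +-0-commutativeMonoid using ()
  renaming (sum to sumℕ; sum-cong-≗ to sumℕ-cong; ∑-distrib-+ to sumℕ-distrib-+)

private
  variable
    m n v w : ℕ

-- Weights

bit : 𝔽₂ → ℕ
bit 0ℙ = 0
bit 1ℙ = 1

∣∣≡sumℕ : (u : Vector 𝔽₂ n) → ∣ u ∣ ≡ sumℕ (bit ∘ u)
∣∣≡sumℕ {zero}  u = refl
∣∣≡sumℕ {suc n} u with u zero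
... | 0ℙ = ∣∣≡sumℕ (u ∘ suc)
... | 1ℙ = cong suc (∣∣≡sumℕ (u ∘ suc))

-- Reduces an identity between sums of weights to an identity between bits, which is then settled by
-- cases on the entries.
∣∣+∣∣≡sumℕ : (u v : Vector 𝔽₂ n) → ∣ u ∣ + ∣ v ∣ ≡ sumℕ (λ i → bit (u i) + bit (v i))
∣∣+∣∣≡sumℕ u v = trans (cong₂ _+_ (∣∣≡sumℕ u) (∣∣≡sumℕ v)) (sym (sumℕ-distrib-+ (bit ∘ u) (bit ∘ v)))

bit≤∣∣ : (u : Vector 𝔽₂ n) (i : Fin n) → bit (u i) ≤ ∣ u ∣
bit≤∣∣ u zero with u zero
... | 0ℙ = z≤n
... | 1ℙ = s≤s z≤n
bit≤∣∣ u (suc i) with u zero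
... | 0ℙ = bit≤∣∣ (u ∘ suc) i
... | 1ℙ = m≤n⇒m≤1+n (bit≤∣∣ (u ∘ suc) i)

bit+bit≤∣∣ : (u : Vector 𝔽₂ n) {i j : Fin n} → i ≢ j → bit (u i) + bit (u j) ≤ ∣ u ∣
bit+bit≤∣∣ u {zero}  {zero}  i≢j = contradiction refl i≢j
bit+bit≤∣∣ u {zero}  {suc j} i≢j with u zero
... | 0ℙ = bit≤∣∣ (u ∘ suc) j
... | 1ℙ = s≤s (bit≤∣∣ (u ∘ suc) j)
bit+bit≤∣∣ u {suc i} {zero}  i≢j =
  ≤-trans (≤-reflexive (+-comm (bit (u (suc i))) _)) (bit+bit≤∣∣ u {zero} {suc i} (i≢j ∘ sym))
bit+bit≤∣∣ u {suc i} {suc j} i≢j with u zero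
... | 0ℙ = bit+bit≤∣∣ (u ∘ suc) (i≢j ∘ cong suc)
... | 1ℙ = m≤n⇒m≤1+n (bit+bit≤∣∣ (u ∘ suc) (i≢j ∘ cong suc))

parity-∣∣ : (u : Vector 𝔽₂ n) → parity ∣ u ∣ ≡ sum u
parity-∣∣ {zero}  u = refl
parity-∣∣ {suc n} u with u zero
... | 0ℙ = parity-∣∣ (u ∘ suc)
... | 1ℙ = trans (ℙₚ.+-homo-+ 1 ∣ u ∘ suc ∣) (cong ℙ._⁻¹ (parity-∣∣ (u ∘ suc)))

∣+ᵥ0∣ : (u : Vector 𝔽₂ n) → ∣ u +ᵥ 0ᵥ ∣ ≡ ∣ u ∣
∣+ᵥ0∣ u = ∣∣-cong λ i → ℙₚ.+-identityʳ (u i)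

∁ : Vector 𝔽₂ n → Vector 𝔽₂ n
∁ u i = u i ℙ.⁻¹

infixl 7 _∩_

_∩_ : Vector 𝔽₂ n → Vector 𝔽₂ n → Vector 𝔽₂ n
(u ∩ v) i = u i ℙ.* v i

∣∣+∣∁∣ : (u : Vector 𝔽₂ n) → ∣ u ∣ + ∣ ∁ u ∣ ≡ n
∣∣+∣∁∣ {zero}  u = refl
∣∣+∣∁∣ {suc n} u with u zero
... | 0ℙ = trans (+-suc _ _) (cong suc (∣∣+∣∁∣ (u ∘ suc)))
... | 1ℙ = cong suc (∣∣+∣∁∣ (u ∘ suc))

-- Adding `g` to `c` clears the entries in `c ∩ g` and sets those in `∁ c ∩ g`. The cleared part
-- stands on the left to avoid truncated subtraction.
∣+ᵥ∣+∣∩∣ : (c g : Vector 𝔽₂ n) → ∣ c +ᵥ g ∣ + ∣ c ∩ g ∣ ≡ ∣ c ∣ + ∣ ∁ c ∩ g ∣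
∣+ᵥ∣+∣∩∣ c g = begin
  ∣ c +ᵥ g ∣ + ∣ c ∩ g ∣                              ≡⟨ ∣∣+∣∣≡sumℕ (c +ᵥ g) (c ∩ g) ⟩
  sumℕ (λ i → bit (c i ℙ.+ g i) + bit (c i ℙ.* g i))  ≡⟨ sumℕ-cong (λ i → pointwise (c i) (g i)) ⟩
  sumℕ (λ i → bit (c i) + bit ((c i) ℙ.⁻¹ ℙ.* g i))   ≡⟨ ∣∣+∣∣≡sumℕ c (∁ c ∩ g) ⟨
  ∣ c ∣ + ∣ ∁ c ∩ g ∣                                 ∎
  where
  open ≡-Reasoning
  pointwise : ∀ p q → bit (p ℙ.+ q) + bit (p ℙ.* q) ≡ bit p + bit (p ℙ.⁻¹ ℙ.* q)
  pointwise 0ℙ 0ℙ = refl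
  pointwise 0ℙ 1ℙ = refl
  pointwise 1ℙ 0ℙ = refl
  pointwise 1ℙ 1ℙ = refl

∣∩∣+∣∁∩∣ : (c g : Vector 𝔽₂ n) → ∣ c ∩ g ∣ + ∣ ∁ c ∩ g ∣ ≡ ∣ g ∣
∣∩∣+∣∁∩∣ c g = begin
  ∣ c ∩ g ∣ + ∣ ∁ c ∩ g ∣                                   ≡⟨ ∣∣+∣∣≡sumℕ (c ∩ g) (∁ c ∩ g) ⟩
  sumℕ (λ i → bit (c i ℙ.* g i) + bit ((c i) ℙ.⁻¹ ℙ.* g i)) ≡⟨ sumℕ-cong (λ i → pointwise (c i) (g i)) ⟩
  sumℕ (bit ∘ g)                                            ≡⟨ ∣∣≡sumℕ g ⟨
  ∣ g ∣                                                     ∎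
  where
  open ≡-Reasoning
  pointwise : ∀ p q → bit (p ℙ.* q) + bit (p ℙ.⁻¹ ℙ.* q) ≡ bit q
  pointwise 0ℙ q = refl
  pointwise 1ℙ q = +-identityʳ (bit q)

∣∁∩∣≤1 : (c g : Vector 𝔽₂ n) → ∣ g ∣ ≤ 3 → ∣ c +ᵥ g ∣ ≤ ∣ c ∣ → ∣ ∁ c ∩ g ∣ ≤ 1
∣∁∩∣≤1 c g g≤3 c+g≤c = ≮⇒≥ λ 2≤z → contradiction (≤-trans (+-mono-≤ (≤-trans 2≤z z≤a) 2≤z)
  (≤-trans (≤-reflexive (∣∩∣+∣∁∩∣ c g)) g≤3)) λ { (s≤s (s≤s (s≤s ()))) }
  where
  -- Since the weight does not grow, at least as many entries are cleared as set. Two entries of `g`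
  -- outside `c` would thus force two more inside, making four in all.
  z≤a : ∣ ∁ c ∩ g ∣ ≤ ∣ c ∩ g ∣
  z≤a = +-cancelˡ-≤ ∣ c ∣ _ _ (≤-trans (≤-reflexive (sym (∣+ᵥ∣+∣∩∣ c g))) (+-monoˡ-≤ ∣ c ∩ g ∣ c+g≤c))

-- Linear algebra

sum-single : (f : Vector 𝔽₂ n) (j : Fin n) → (∀ k → k ≢ j → f k ≡ 0ℙ) → sum f ≡ f j
sum-single {suc n} f zero    f≡0 = trans
  (cong (f zero ℙ.+_) (trans (sum-cong-≗ λ k → f≡0 (suc k) λ ()) (sum-replicate-zero n)))
  (ℙₚ.+-identityʳ (f zero))
sum-single {suc n} f (suc j) f≡0 = cong₂ ℙ._+_ (f≡0 zero λ ())
  (sum-single (f ∘ suc) j λ k k≢j → f≡0 (suc k) λ { refl → k≢j refl })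

*ᵥ-+ᵥ : (W : Matrix m n) (x y : Vector 𝔽₂ n) → W *ᵥ (x +ᵥ y) ≗ (W *ᵥ x) +ᵥ (W *ᵥ y)
*ᵥ-+ᵥ W x y i = trans (sum-cong-≗ λ j → ℙₚ.*-distribˡ-+ (W i j) (x j) (y j))
  (∑-distrib-+ (λ j → W i j ℙ.* x j) (λ j → W i j ℙ.* y j))

basis : Fin n → Vector 𝔽₂ n
basis j k with k ≟ᶠ j
... | yes _ = 1ℙ
... | no  _ = 0ℙ

basis-≡ : (j : Fin n) → basis j j ≡ 1ℙ
basis-≡ j with j ≟ᶠ j
... | yes _   = refl
... | no  j≢j = contradiction refl j≢j

basis-≢ : {j k : Fin n} → k ≢ j → basis j k ≡ 0ℙ
basis-≢ {j = j} {k} k≢j with k ≟ᶠ j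
... | yes k≡j = contradiction k≡j k≢j
... | no  _   = refl

*ᵥ-basis : (W : Matrix m n) (j : Fin n) (i : Fin m) → (W *ᵥ basis j) i ≡ W i j
*ᵥ-basis W j i = trans
  (sum-single (λ k → W i k ℙ.* basis j k) j λ k k≢j →
    trans (cong (W i k ℙ.*_) (basis-≢ k≢j)) (ℙₚ.*-zeroʳ (W i k)))
  (trans (cong (W i j ℙ.*_) (basis-≡ j)) (ℙₚ.*-identityʳ (W i j)))

-- Modulo 2 a weight is the sum of the entries. Summing `W *ᵥ x` by columns, each column selected by
-- `x` contributes its degree, which is odd.
parity-∣*ᵥ∣ : (W : Matrix n n) → (∀ j → parity (degree W j) ≡ 1ℙ) → ∀ x → parity ∣ W *ᵥ x ∣ ≡ parity ∣ x ∣
parity-∣*ᵥ∣ W odd x = begin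
  parity ∣ W *ᵥ x ∣                        ≡⟨ parity-∣∣ (W *ᵥ x) ⟩
  sum (λ i → sum (λ j → W i j ℙ.* x j))    ≡⟨ ∑-comm (λ i j → W i j ℙ.* x j) ⟩
  sum (λ j → sum (λ i → W i j ℙ.* x j))    ≡⟨ sum-cong-≗ (λ j → *-distribʳ-sum (x j) (λ i → W i j)) ⟨
  sum (λ j → sum (λ i → W i j) ℙ.* x j)    ≡⟨ sum-cong-≗ (λ j → cong (ℙ._* x j) (trans (sym (parity-∣∣ (λ i → W i j))) (odd j))) ⟩
  sum x                                    ≡⟨ parity-∣∣ x ⟨
  parity ∣ x ∣                             ∎
  where open ≡-Reasoning

-- Lower bounds

Bounded : Matrix n n → ℕ → Set
Bounded W v = ∀ x → ∣ W *ᵥ x ∣ ≤ v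

module _ (W : Matrix n n) (wiring : IsWiring W) (degree≤3 : ∀ j → degree W j ≤ 3)
         (x : Vector 𝔽₂ n) (maximal : Bounded W ∣ W *ᵥ x ∣) where

  private
    c s : Vector 𝔽₂ n
    c = W *ᵥ x
    s = W *ᵥ ∁ c

    c+W*-bounded : ∀ y → ∣ c +ᵥ W *ᵥ y ∣ ≤ ∣ c ∣
    c+W*-bounded y = ≤-trans (≤-reflexive (∣∣-cong λ i → sym (*ᵥ-+ᵥ W x y i))) (maximal (x +ᵥ y))

    column-∩ : ∀ j → ∣ ∁ c ∩ (λ i → W i j) ∣ ≤ 1
    column-∩ j = ∣∁∩∣≤1 c (λ i → W i j) (degree≤3 j)
      (≤-trans (≤-reflexive (∣∣-cong λ i → cong (c i ℙ.+_) (sym (*ᵥ-basis W j i)))) (c+W*-bounded (basis j)))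

    -- For distinct `i` and `j` in `∁ c`, an entry `W i j` equal to 1 would, together with the
    -- diagonal entry `W j j`, give column `j` two ones in `∁ c`.
    off-diagonal : ∀ i j → i ≢ j → ∁ c i ≡ 1ℙ → W i j ℙ.* ∁ c j ≡ 0ℙ
    off-diagonal i j i≢j ci with W i j in Wij | ∁ c j in cj
    ... | 0ℙ | _  = refl
    ... | 1ℙ | 0ℙ = refl
    ... | 1ℙ | 1ℙ = contradiction (≤-trans (≤-reflexive (sym (cong₂ _+_ eᵢ eⱼ)))
            (≤-trans (bit+bit≤∣∣ (∁ c ∩ (λ i → W i j)) i≢j) (column-∩ j))) λ { (s≤s ()) }
      where
      eᵢ : bit (∁ c i ℙ.* W i j) ≡ 1
      eᵢ = cong bit (cong₂ ℙ._*_ ci Wij)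
      eⱼ : bit (∁ c j ℙ.* W j j) ≡ 1
      eⱼ = cong bit (cong₂ ℙ._*_ cj (wiring j))

    s-covers-∁c : ∀ i → ∁ c i ≡ 1ℙ → s i ≡ 1ℙ
    s-covers-∁c i ci = trans
      (sum-single (λ j → W i j ℙ.* ∁ c j) i λ j j≢i → off-diagonal i j (j≢i ∘ sym) ci)
      (cong₂ ℙ._*_ (wiring i) ci)

    -- Outside the support of `c`, both `s` and `c +ᵥ s` have a 1. On the support, exactly one of
    -- them does.
    pointwise : ∀ p q → (p ℙ.⁻¹ ≡ 1ℙ → q ≡ 1ℙ) →
                bit q + bit (p ℙ.+ q) ≡ (bit (p ℙ.⁻¹) + bit (p ℙ.⁻¹)) + bit p
    pointwise 0ℙ q h rewrite h refl = refl
    pointwise 1ℙ 0ℙ _ = refl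
    pointwise 1ℙ 1ℙ _ = refl

  ∣s∣+∣c+s∣ : ∣ s ∣ + ∣ c +ᵥ s ∣ ≡ (∣ ∁ c ∣ + ∣ ∁ c ∣) + ∣ c ∣
  ∣s∣+∣c+s∣ = begin
    ∣ s ∣ + ∣ c +ᵥ s ∣                                            ≡⟨ ∣∣+∣∣≡sumℕ s (c +ᵥ s) ⟩
    sumℕ (λ i → bit (s i) + bit (c i ℙ.+ s i))                   ≡⟨ sumℕ-cong (λ i → pointwise (c i) (s i) (s-covers-∁c i)) ⟩
    sumℕ (λ i → (bit (∁ c i) + bit (∁ c i)) + bit (c i))         ≡⟨ sumℕ-distrib-+ (λ i → bit (∁ c i) + bit (∁ c i)) (bit ∘ c) ⟩
    sumℕ (λ i → bit (∁ c i) + bit (∁ c i)) + sumℕ (bit ∘ c)      ≡⟨ cong₂ _+_ (∣∣+∣∣≡sumℕ (∁ c) (∁ c)) (∣∣≡sumℕ c) ⟨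
    (∣ ∁ c ∣ + ∣ ∁ c ∣) + ∣ c ∣                                  ∎
    where open ≡-Reasoning

  2∣∁c∣≤∣c∣ : ∣ ∁ c ∣ + ∣ ∁ c ∣ ≤ ∣ c ∣
  2∣∁c∣≤∣c∣ = +-cancelʳ-≤ ∣ c ∣ _ _
    (≤-trans (≤-reflexive (sym ∣s∣+∣c+s∣)) (+-mono-≤ (maximal (∁ c)) (c+W*-bounded (∁ c))))

  2n≤3∣c∣ : 2 * n ≤ 3 * ∣ c ∣
  2n≤3∣c∣ = begin
    2 * n                                ≡⟨ cong (2 *_) (∣∣+∣∁∣ c) ⟨
    2 * (∣ c ∣ + ∣ ∁ c ∣)                ≡⟨ solve 2 (λ a z → con 2 :* (a :+ z) := con 2 :* a :+ (z :+ z)) refl ∣ c ∣ ∣ ∁ c ∣ ⟩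
    2 * ∣ c ∣ + (∣ ∁ c ∣ + ∣ ∁ c ∣)      ≤⟨ +-monoʳ-≤ (2 * ∣ c ∣) 2∣∁c∣≤∣c∣ ⟩
    2 * ∣ c ∣ + ∣ c ∣                    ≡⟨ +-comm (2 * ∣ c ∣) ∣ c ∣ ⟩
    3 * ∣ c ∣                            ∎
    where
    open ≤-Reasoning
    open +-*-Solver

  3∣c∣≡2n⇒n-even : (∀ j → degree W j ≡ 3) → 3 * ∣ c ∣ ≡ 2 * n → parity n ≡ 0ℙ
  3∣c∣≡2n⇒n-even degree≡3 3∣c∣≡2n = begin
    parity n                               ≡⟨ cong parity (∣∣+∣∁∣ c) ⟨
    parity (∣ c ∣ + ∣ ∁ c ∣)               ≡⟨ ℙₚ.+-homo-+ ∣ c ∣ ∣ ∁ c ∣ ⟩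
    -- Both parities equal that of `s`: the first because the weights agree, the second because all
    -- columns have odd weight.
    parity ∣ c ∣ ℙ.+ parity ∣ ∁ c ∣        ≡⟨ cong₂ ℙ._+_ (cong parity ∣s∣≡∣c∣) (parity-∣*ᵥ∣ W (cong parity ∘ degree≡3) (∁ c)) ⟨
    parity ∣ s ∣ ℙ.+ parity ∣ s ∣          ≡⟨ ℙₚ.p+p≡0ℙ (parity ∣ s ∣) ⟩
    0ℙ                                     ∎
    where
    open ≡-Reasoning

    2∣∁c∣≡∣c∣ : ∣ ∁ c ∣ + ∣ ∁ c ∣ ≡ ∣ c ∣
    2∣∁c∣≡∣c∣ = +-cancelˡ-≡ (2 * ∣ c ∣) _ _ (begin
      2 * ∣ c ∣ + (∣ ∁ c ∣ + ∣ ∁ c ∣)      ≡⟨ solve 2 (λ a z → con 2 :* a :+ (z :+ z) := con 2 :* (a :+ z)) refl ∣ c ∣ ∣ ∁ c ∣ ⟩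
      2 * (∣ c ∣ + ∣ ∁ c ∣)                ≡⟨ cong (2 *_) (∣∣+∣∁∣ c) ⟩
      2 * n                                ≡⟨ 3∣c∣≡2n ⟨
      3 * ∣ c ∣                            ≡⟨ +-comm ∣ c ∣ (2 * ∣ c ∣) ⟩
      2 * ∣ c ∣ + ∣ c ∣                    ∎)
      where open +-*-Solver

    -- The weights of `s` and `c +ᵥ s` now add up to twice that of `c`, and neither exceeds it, so
    -- both equal it.
    ∣s∣≡∣c∣ : ∣ s ∣ ≡ ∣ c ∣
    ∣s∣≡∣c∣ = ≤-antisym (maximal (∁ c)) (+-cancelʳ-≤ ∣ c ∣ _ _
      (≤-trans (≤-reflexive (sym (trans ∣s∣+∣c+s∣ (cong (_+ ∣ c ∣) 2∣∁c∣≡∣c∣))))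
        (+-monoʳ-≤ ∣ s ∣ (c+W*-bounded (∁ c)))))

-- Transfer of the bounds to `M`, `μ` and `μ*`.

M-attained : (W : Matrix n n) → ∃ λ x → ∣ W *ᵥ x ∣ ≡ M W 0ᵥ
M-attained W with M-exists W 0ᵥ
... | _ , (x , eq) , _ = x , trans (sym (∣+ᵥ0∣ (W *ᵥ x))) eq

M-bounded : (W : Matrix n n) → Bounded W (M W 0ᵥ)
M-bounded W x = proj₂ (proj₂ (M-exists W 0ᵥ)) ∣ W *ᵥ x ∣ (x , ∣+ᵥ0∣ (W *ᵥ x))

M-least : (W : Matrix n n) → Bounded W v → M W 0ᵥ ≤ v
M-least W bounded with M-attained W
... | x , eq = ≤-trans (≤-reflexive (sym eq)) (bounded x)

≤foldr-⊔ : (u : Vector ℕ n) (i : Fin n) → u i ≤ foldr _⊔_ 0 u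
≤foldr-⊔ u zero    = m≤m⊔n (u zero) _
≤foldr-⊔ u (suc i) = ≤-trans (≤foldr-⊔ (u ∘ suc) i) (m≤n⊔m (u zero) _)

2n≤3M : (W : Matrix n n) → A n 3 W → 2 * n ≤ 3 * M W 0ᵥ
2n≤3M {n} W (wiring , deg≤3) with M-attained W
... | x , eq = subst (λ k → 2 * n ≤ 3 * k) eq
  (2n≤3∣c∣ W wiring (λ j → ≤-trans (≤foldr-⊔ (degree W) j) deg≤3) x (subst (Bounded W) (sym eq) (M-bounded W)))

3M≡2n⇒n-even : (W : Matrix n n) → A* n 3 W → 3 * M W 0ᵥ ≡ 2 * n → parity n ≡ 0ℙ
3M≡2n⇒n-even {n} W (wiring , degree≡3) 3M≡2n with M-attained W
... | x , eq = 3∣c∣≡2n⇒n-even W wiring (≤-reflexive ∘ degree≡3) x (subst (Bounded W) (sym eq) (M-bounded W))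
  degree≡3 (trans (cong (3 *_) eq) 3M≡2n)

A*⊆A : (W : Matrix n n) → A* n m W → A n m W
A*⊆A W (wiring , degree≡m) = wiring , foldr-⊔-lub (≤-reflexive ∘ degree≡m)

2n≤3μ : ∀ n → 2 * n ≤ 3 * μ n 3
2n≤3μ n with μ-exists n 3
... | _ , (W , W∈A , refl) , _ = 2n≤3M W W∈A

μ₃≤μ₂ : ∀ n → μ n 3 ≤ μ n 2
μ₃≤μ₂ n with μ-exists n 2
... | v , (W , (wiring , deg≤2) , eq) , _ = proj₂ (proj₂ (μ-exists n 3)) v (W , (wiring , m≤n⇒m≤1+n deg≤2) , eq)

μ₃≤μ*₃ : ∀ n (3≤n : 3 ≤ n) → μ n 3 ≤ μ* n 3 3≤n
μ₃≤μ*₃ n 3≤n with μ*-exists n 3 3≤n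
... | v , (W , W∈A* , eq) , _ = proj₂ (proj₂ (μ-exists n 3)) v (W , A*⊆A W W∈A* , eq)

3μ*≡2n⇒n-even : ∀ n (3≤n : 3 ≤ n) → 3 * μ* n 3 3≤n ≡ 2 * n → parity n ≡ 0ℙ
3μ*≡2n⇒n-even n 3≤n eq with μ*-exists n 3 3≤n
... | _ , (W , W∈A* , refl) , _ = 3M≡2n⇒n-even W W∈A* eq

-- Block sums

blocks : Matrix m m → Matrix n n → Fin m ⊎ Fin n → Fin m ⊎ Fin n → 𝔽₂
blocks U V (inj₁ i) (inj₁ j) = U i j
blocks U V (inj₂ i) (inj₂ j) = V i j
blocks U V _        _        = 0ℙ

infixl 6 _⊕_

_⊕_ : Matrix m m → Matrix n n → Matrix (m + n) (m + n)
_⊕_ {m} U V i j = blocks U V (splitAt m i) (splitAt m j)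

∣∣-split : ∀ m (u : Vector 𝔽₂ (m + n)) → ∣ u ∣ ≡ ∣ u ∘ (_↑ˡ n) ∣ + ∣ u ∘ (m ↑ʳ_) ∣
∣∣-split zero    u = refl
∣∣-split (suc m) u with u zero
... | 0ℙ = ∣∣-split m (u ∘ suc)
... | 1ℙ = cong suc (∣∣-split m (u ∘ suc))

sum-split : ∀ m (u : Vector 𝔽₂ (m + n)) → sum u ≡ sum (u ∘ (_↑ˡ n)) ℙ.+ sum (u ∘ (m ↑ʳ_))
sum-split zero    u = refl
sum-split (suc m) u = trans (cong (u zero ℙ.+_) (sum-split m (u ∘ suc))) (sym (ℙₚ.+-assoc (u zero) _ _))

∣0∣ : ∀ n → ∣ 0ᵥ {n} ∣ ≡ 0
∣0∣ zero    = refl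
∣0∣ (suc n) = ∣0∣ n

module _ (U : Matrix m m) (V : Matrix n n) where

  ⊕-ˡˡ : ∀ i j → (U ⊕ V) (i ↑ˡ n) (j ↑ˡ n) ≡ U i j
  ⊕-ˡˡ i j = cong₂ (blocks U V) (splitAt-↑ˡ m i n) (splitAt-↑ˡ m j n)

  ⊕-ˡʳ : ∀ i j → (U ⊕ V) (i ↑ˡ n) (m ↑ʳ j) ≡ 0ℙ
  ⊕-ˡʳ i j = cong₂ (blocks U V) (splitAt-↑ˡ m i n) (splitAt-↑ʳ m n j)

  ⊕-ʳˡ : ∀ i j → (U ⊕ V) (m ↑ʳ i) (j ↑ˡ n) ≡ 0ℙ
  ⊕-ʳˡ i j = cong₂ (blocks U V) (splitAt-↑ʳ m n i) (splitAt-↑ˡ m j n)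

  ⊕-ʳʳ : ∀ i j → (U ⊕ V) (m ↑ʳ i) (m ↑ʳ j) ≡ V i j
  ⊕-ʳʳ i j = cong₂ (blocks U V) (splitAt-↑ʳ m n i) (splitAt-↑ʳ m n j)

  ⊕-*ᵥ-ˡ : ∀ x i → ((U ⊕ V) *ᵥ x) (i ↑ˡ n) ≡ (U *ᵥ (x ∘ (_↑ˡ n))) i
  ⊕-*ᵥ-ˡ x i = trans (sum-split m (λ j → (U ⊕ V) (i ↑ˡ n) j ℙ.* x j))
    (trans (cong₂ ℙ._+_ (sum-cong-≗ λ j → cong (ℙ._* x (j ↑ˡ n)) (⊕-ˡˡ i j))
      (trans (sum-cong-≗ λ j → cong (ℙ._* x (m ↑ʳ j)) (⊕-ˡʳ i j)) (sum-replicate-zero n)))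
      (ℙₚ.+-identityʳ _))

  ⊕-*ᵥ-ʳ : ∀ x i → ((U ⊕ V) *ᵥ x) (m ↑ʳ i) ≡ (V *ᵥ (x ∘ (m ↑ʳ_))) i
  ⊕-*ᵥ-ʳ x i = trans (sum-split m (λ j → (U ⊕ V) (m ↑ʳ i) j ℙ.* x j))
    (cong₂ ℙ._+_
      (trans (sum-cong-≗ λ j → cong (ℙ._* x (j ↑ˡ n)) (⊕-ʳˡ i j)) (sum-replicate-zero m))
      (sum-cong-≗ λ j → cong (ℙ._* x (m ↑ʳ j)) (⊕-ʳʳ i j)))

  -- Every image under `U ⊕ V` is an image under `U` followed by an image under `V`, and the weights
  -- of the two halves add.
  ⊕-bounded : Bounded U v → Bounded V w → Bounded (U ⊕ V) (v + w)
  ⊕-bounded U≤v V≤w x = ≤-trans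
    (≤-reflexive (trans (∣∣-split m ((U ⊕ V) *ᵥ x)) (cong₂ _+_ (∣∣-cong (⊕-*ᵥ-ˡ x)) (∣∣-cong (⊕-*ᵥ-ʳ x)))))
    (+-mono-≤ (U≤v _) (V≤w _))

  degree-⊕-ˡ : ∀ j → degree (U ⊕ V) (j ↑ˡ n) ≡ degree U j
  degree-⊕-ˡ j = trans (∣∣-split m (λ i → (U ⊕ V) i (j ↑ˡ n)))
    (trans (cong₂ _+_ (∣∣-cong λ i → ⊕-ˡˡ i j) (trans (∣∣-cong λ i → ⊕-ʳˡ i j) (∣0∣ n))) (+-identityʳ _))

  degree-⊕-ʳ : ∀ j → degree (U ⊕ V) (m ↑ʳ j) ≡ degree V j
  degree-⊕-ʳ j = trans (∣∣-split m (λ i → (U ⊕ V) i (m ↑ʳ j)))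
    (cong₂ _+_ (trans (∣∣-cong λ i → ⊕-ˡʳ i j) (∣0∣ m)) (∣∣-cong λ i → ⊕-ʳʳ i j))

↑-cases : ∀ m {n} (P : Pred (Fin (m + n)) 0ℓ) → (∀ i → P (i ↑ˡ n)) → (∀ i → P (m ↑ʳ i)) → ∀ i → P i
↑-cases m {n} P l r i with splitAt m i | join-splitAt m n i
... | inj₁ j | refl = l j
... | inj₂ j | refl = r j

-- Upper bounds

-- The predicate is `_≤ m` for `A` and `_≡ m` for `A*`, so that both share the block sums and the
-- finite checks.
Realised : Pred ℕ 0ℓ → ℕ → ℕ → Set
Realised P n v = ∃ λ (W : Matrix n n) → IsWiring W × (∀ j → P (degree W j)) × Bounded W v

Realised-+ : (P : Pred ℕ 0ℓ) → Realised P m v → Realised P n w → Realised P (m + n) (v + w)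
Realised-+ {m} P (U , U-wiring , U-degree , U≤v) (V , V-wiring , V-degree , V≤w) =
  U ⊕ V ,
  ↑-cases m _ (λ i → trans (⊕-ˡˡ U V i i) (U-wiring i)) (λ i → trans (⊕-ʳʳ U V i i) (V-wiring i)) ,
  ↑-cases m _ (λ j → subst P (sym (degree-⊕-ˡ U V j)) (U-degree j))
              (λ j → subst P (sym (degree-⊕-ʳ U V j)) (V-degree j)) ,
  ⊕-bounded U V U≤v V≤w

module _ {P : Pred ℕ 0ℓ} (P? : Decidable P) where

  Checked : Matrix n n → ℕ → Set
  Checked {n} W v = IsWiring W × (∀ j → P (degree W j)) × All (λ x → ∣ W *ᵥ x ∣ ≤ v) (allVectors n)

  checked? : (W : Matrix n n) (v : ℕ) → Dec (Checked W v)
  checked? {n} W v = isWiring? W ×-dec all? (λ j → P? (degree W j)) ×-dec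
    All.all? (λ x → ∣ W *ᵥ x ∣ ≤? v) (allVectors n)

  -- The implicit argument is solved by evaluating the decision procedure, so a concrete wiring is
  -- verified on all vectors during type checking.
  realised : (W : Matrix n n) (v : ℕ) → {True (checked? W v)} → Realised P n v
  realised {n} W v {t} with toWitness t
  ... | wiring , degrees , weights = W , wiring , degrees , bounded
    where
    bounded : Bounded W v
    bounded x with find (allVectors-exhaustive x)
    ... | y , y∈ , x≗y = ≤-trans
      (≤-reflexive (∣∣-cong λ i → sum-cong-≗ λ j → cong (W i j ℙ.*_) (x≗y j))) (All.lookup weights y∈)

-- Small wirings

fromColumns : Vec (Vec 𝔽₂ n) n → Matrix n n
fromColumns cs i j = lookup (lookup cs j) i

pattern ○ = 0ℙ
pattern ● = 1ℙ

1-realised : Realised (_≤ 2) 1 1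
1-realised = realised (_≤? 2) (fromColumns ((● ∷ []) ∷ [])) 1

2-realised : Realised (_≤ 2) 2 2
2-realised = realised (_≤? 2) (fromColumns (a ∷ a ∷ [])) 2
  where a = ● ∷ ● ∷ []

-- All images have even weight, hence weight at most 2 among three entries.
3-realised : Realised (_≤ 2) 3 2
3-realised = realised (_≤? 2) (fromColumns (a ∷ b ∷ b ∷ [])) 2
  where
  a = ● ∷ ● ∷ ○ ∷ []
  b = ○ ∷ ● ∷ ● ∷ []

3-realised* : Realised (_≡ 3) 3 3
3-realised* = realised (_≟ 3) (fromColumns (a ∷ a ∷ a ∷ [])) 3
  where a = ● ∷ ● ∷ ● ∷ []

-- Every image has even weight on the last three entries, so at most 2 there and at most 3 in all.
4-realised* : Realised (_≡ 3) 4 3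
4-realised* = realised (_≟ 3) (fromColumns (a ∷ a ∷ a ∷ b ∷ [])) 3
  where
  a = ● ∷ ● ∷ ● ∷ ○ ∷ []
  b = ● ∷ ● ∷ ○ ∷ ● ∷ []

-- The only nonzero images are `a`, `b` and their sum, of weights 3, 3 and 4.
5-realised* : Realised (_≡ 3) 5 4
5-realised* = realised (_≟ 3) (fromColumns (a ∷ a ∷ a ∷ b ∷ b ∷ [])) 4
  where
  a = ● ∷ ● ∷ ● ∷ ○ ∷ ○ ∷ []
  b = ● ∷ ○ ∷ ○ ∷ ● ∷ ● ∷ []

-- The columns are vertex stars of K₄, so that the W x are its edge cuts, which
-- have at most 4 edges.
6-realised* : Realised (_≡ 3) 6 4
6-realised* = realised (_≟ 3) (fromColumns (a ∷ a ∷ a ∷ b ∷ b ∷ c ∷ [])) 4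
  where
  a = ● ∷ ● ∷ ● ∷ ○ ∷ ○ ∷ ○ ∷ []
  b = ● ∷ ○ ∷ ○ ∷ ● ∷ ● ∷ ○ ∷ []
  c = ○ ∷ ● ∷ ○ ∷ ● ∷ ○ ∷ ● ∷ []

-- Apart from the first entry there are two triples, and every image has even weight on each. This
-- gives at most 1 + 2 + 2.
7-realised* : Realised (_≡ 3) 7 5
7-realised* = realised (_≟ 3) (fromColumns (a ∷ a ∷ a ∷ b ∷ c ∷ c ∷ d ∷ [])) 5
  where
  a = ● ∷ ● ∷ ● ∷ ○ ∷ ○ ∷ ○ ∷ ○ ∷ []
  b = ● ∷ ● ∷ ○ ∷ ● ∷ ○ ∷ ○ ∷ ○ ∷ []
  c = ● ∷ ○ ∷ ○ ∷ ○ ∷ ● ∷ ● ∷ ○ ∷ []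
  d = ● ∷ ○ ∷ ○ ∷ ○ ∷ ● ∷ ○ ∷ ● ∷ []

-- 3 v ≤ 2 + 2 n says that v ≤ ⌈ 2 n / 3 ⌉.
Efficient : Pred ℕ 0ℓ → ℕ → Set
Efficient P n = ∃ λ v → Realised P n v × 3 * v ≤ 2 + 2 * n

-- A block of ratio exactly 2/3 uses none of the slack 2, so any loss by rounding stays in the
-- remaining block.
Efficient-+ : (P : Pred ℕ 0ℓ) → Realised P m v → 3 * v ≡ 2 * m → Efficient P n → Efficient P (m + n)
Efficient-+ {m} {v} {n} P realised eq (w , realised′ , 3w≤) = v + w , Realised-+ P realised realised′ , (begin
  3 * (v + w)            ≡⟨ *-distribˡ-+ 3 v w ⟩
  3 * v + 3 * w          ≤⟨ +-mono-≤ (≤-reflexive eq) 3w≤ ⟩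
  2 * m + (2 + 2 * n)    ≡⟨ solve 2 (λ m n → con 2 :* m :+ (con 2 :+ con 2 :* n) := con 2 :+ con 2 :* (m :+ n)) refl m n ⟩
  2 + 2 * (m + n)        ∎)
  where
  open ≤-Reasoning
  open +-*-Solver

efficient : ∀ n → Efficient (_≤ 2) n
efficient 0 = 0 , ((λ ()) , (λ ()) , (λ ()) , λ _ → z≤n) , z≤n
efficient 1 = 1 , 1-realised , toWitness {a? = 3 ≤? 4} _
efficient 2 = 2 , 2-realised , toWitness {a? = 6 ≤? 6} _
efficient (suc (suc (suc n))) = Efficient-+ (_≤ 2) 3-realised refl (efficient n)

pattern 6+ n = suc (suc (suc (suc (suc (suc n)))))

efficient* : ∀ n → 3 ≤ n → (∀ k → n ≢ 3 + k * 6) → Efficient (_≡ 3) n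
efficient* 1 (s≤s ()) _
efficient* 2 (s≤s (s≤s ())) _
efficient* 3 _ n≢ = contradiction refl (n≢ 0)
efficient* 4 _ _ = 3 , 4-realised* , toWitness {a? = 9 ≤? 10} _
efficient* 5 _ _ = 4 , 5-realised* , toWitness {a? = 12 ≤? 12} _
-- The values 6, 7 and 8 are base cases: splitting off six vertices would leave fewer than three,
-- too few for degree 3.
efficient* (6+ 0) _ _ = 4 , 6-realised* , toWitness {a? = 12 ≤? 14} _
efficient* (6+ 1) _ _ = 5 , 7-realised* , toWitness {a? = 15 ≤? 16} _
efficient* (6+ 2) _ _ = 6 , Realised-+ (_≡ 3) 4-realised* 4-realised* , toWitness {a? = 18 ≤? 18} _
-- The excluded residue class is preserved by subtracting 6. In particular 9 would descend to 3, and
-- both are excluded.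
efficient* (6+ n@(suc (suc (suc _)))) _ n≢ = Efficient-+ (_≡ 3) 6-realised* refl
  (efficient* n (s≤s (s≤s (s≤s z≤n))) λ k eq → n≢ (suc k) (cong (6 +_) eq))

-- One block on three vertices, of value 3 instead of 2, is joined to `k` blocks of ratio 2/3, so
-- the total exceeds two thirds of the number of vertices by exactly 1.
realised-3+6k : ∀ k → Realised (_≡ 3) (3 + k * 6) (3 + k * 4)
realised-3+6k zero    = 3-realised*
realised-3+6k (suc k) = Realised-+ (_≡ 3) 6-realised* (realised-3+6k k)

-- Values of `μ` and `μ*`

μ≤ : .{{_ : NonZero m}} → Realised (_≤ m) n v → μ n m ≤ v
μ≤ {m} {n} (W , wiring , degrees , bounded) =
  ≤-trans (proj₂ (proj₂ (μ-exists n m)) _ (W , (wiring , foldr-⊔-lub degrees) , refl)) (M-least W bounded)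

μ*≤ : .{{_ : NonZero m}} (m≤n : m ≤ n) → Realised (_≡ m) n v → μ* n m m≤n ≤ v
μ*≤ {m} {n} m≤n (W , wiring , degrees , bounded) =
  ≤-trans (proj₂ (proj₂ (μ*-exists n m m≤n)) _ (W , (wiring , degrees) , refl)) (M-least W bounded)

-- Integrality: `μ n 3` is at least 2n/3, hence at least its ceiling, which bounds `v`.
efficient≤μ₃ : 3 * v ≤ 2 + 2 * n → v ≤ μ n 3
efficient≤μ₃ {v} {n} 3v≤ = ≮⇒≥ λ μ<v → <-irrefl refl (begin-strict
  2 + 2 * n          ≤⟨ +-monoʳ-≤ 2 (2n≤3μ n) ⟩
  2 + 3 * μ n 3      <⟨ n<1+n _ ⟩
  3 + 3 * μ n 3      ≡⟨ *-suc 3 (μ n 3) ⟨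
  3 * suc (μ n 3)    ≤⟨ *-monoʳ-≤ 3 μ<v ⟩
  3 * v              ≤⟨ 3v≤ ⟩
  2 + 2 * n          ∎)
  where open ≤-Reasoning

μ₃≡μ₂ : ∀ n → μ n 3 ≡ μ n 2
μ₃≡μ₂ n with efficient n
-- The efficient wirings already have degree at most 2, yet their value meets the lower bound for
-- degree 3.
... | _ , realised , 3v≤ = ≤-antisym (μ₃≤μ₂ n) (≤-trans (μ≤ realised) (efficient≤μ₃ 3v≤))

μ*₃≡μ₃ : ∀ n (3≤n : 3 ≤ n) → (∀ k → n ≢ 3 + k * 6) → μ* n 3 3≤n ≡ μ n 3
μ*₃≡μ₃ n 3≤n n≢ with efficient* n 3≤n n≢
... | _ , realised , 3v≤ = ≤-antisym (≤-trans (μ*≤ 3≤n realised) (efficient≤μ₃ 3v≤)) (μ₃≤μ*₃ n 3≤n)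

3+6k-odd : ∀ k → parity (3 + k * 6) ≢ 0ℙ
3+6k-odd zero    ()
3+6k-odd (suc k) = 3+6k-odd k

μ*₃-3+6k : ∀ k (3≤n : 3 ≤ 3 + k * 6) → μ* (3 + k * 6) 3 3≤n ≡ 3 + k * 4
-- The bound 2n/3 is the integer `2 + k * 4`, and equality is impossible because n is odd. The
-- resulting strict inequality is by definition the bound `3 + k * 4`.
μ*₃-3+6k k 3≤n = ≤-antisym (μ*≤ 3≤n (realised-3+6k k)) (*-cancelˡ-< 3 _ _ (begin-strict
  3 * (2 + k * 4)             ≡⟨ 3[2+4k] ⟩
  2 * (3 + k * 6)             <⟨ ≤∧≢⇒< 2n≤3μ* (3μ*≢2n ∘ sym) ⟩
  3 * μ* (3 + k * 6) 3 3≤n    ∎))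
  where
  open ≤-Reasoning
  open +-*-Solver

  3[2+4k] : 3 * (2 + k * 4) ≡ 2 * (3 + k * 6)
  3[2+4k] = solve 1 (λ k → con 3 :* (con 2 :+ k :* con 4) := con 2 :* (con 3 :+ k :* con 6)) refl k

  2n≤3μ* : 2 * (3 + k * 6) ≤ 3 * μ* (3 + k * 6) 3 3≤n
  2n≤3μ* = ≤-trans (2n≤3μ (3 + k * 6)) (*-monoʳ-≤ 3 (μ₃≤μ*₃ (3 + k * 6) 3≤n))

  3μ*≢2n : 3 * μ* (3 + k * 6) 3 3≤n ≢ 2 * (3 + k * 6)
  3μ*≢2n = 3+6k-odd k ∘ 3μ*≡2n⇒n-even (3 + k * 6) 3≤n

6[1+k]∸3 : ∀ k → 6 * suc k ∸ 3 ≡ 3 + k * 6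
6[1+k]∸3 k = cong (_∸ 3) (*-comm 6 (suc k))

4[1+k]∸1 : ∀ k → 4 * suc k ∸ 1 ≡ 3 + k * 4
4[1+k]∸1 k = cong (_∸ 1) (*-comm 4 (suc k))

theorem1p2 : (n : ℕ) → 1 ≤ n →
    (μ n 3 ≡ μ n 2) ×
    ((3≤n : 3 ≤ n) →
    ((k : ℕ) → 1 ≤ k → n ≡ 6 * k ∸ 3 → μ* n 3 3≤n ≡ 4 * k ∸ 1) ×
    (¬ (∃ λ (k : ℕ) → 1 ≤ k × n ≡ 6 * k ∸ 3) → μ* n 3 3≤n ≡ μ n 3))
theorem1p2 n _ = μ₃≡μ₂ n , λ 3≤n →
  -- The index of the statement starts at 1, that of the construction at 0.
  (λ { (suc k) _ n≡ → trans (special k 3≤n (trans n≡ (6[1+k]∸3 k))) (sym (4[1+k]∸1 k)) }) ,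
  λ n≢ → μ*₃≡μ₃ n 3≤n λ k n≡ → n≢ (suc k , s≤s z≤n , trans n≡ (sym (6[1+k]∸3 k)))
  where
  -- With `n` a variable the equation can be matched with `refl`, which carries along the proof
  -- `3≤n` on which `μ*` depends.
  special : ∀ {n} k (3≤n : 3 ≤ n) → n ≡ 3 + k * 6 → μ* n 3 3≤n ≡ 3 + k * 4
  special k 3≤n refl = μ*₃-3+6k k 3≤n
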